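{- Let $\Sigma_1=(G_1,\sigma_1)$ and $\Sigma_2=(G_2,\sigma_2)$ be two finite, simple, connected signed graphs and let $\Sigma_1\boxtimes\Sigma_2$ be their strong product. Then $$\operatorname{bdim}(\Sigma_1\boxtimes\Sigma_2)=\begin{cases}\operatorname{bdim}(\Sigma_1), & \text{if } \Sigma_2 \text{ is balanced},\\ \operatorname{bdim}(\Sigma_2), & \text{if } \Sigma_1 \text{ is balanced}.\end{cases}$$
   Context: A signed graph $\Sigma=(G,\sigma)$ is a graph $G=(V,E)$ with a function $\sigma:E\to\{+1,-1\}$. All graphs are finite, simple, connected and undirected unless otherwise mentioned. The sign of a cycle is the product of the signs of its edges; $\Sigma$ is balanced if it has no cycle of sign $-1$. Let $\Omega=\{ -1,0,1\}$, with $\Omega^k\subset\mathbb{R}^k$ carrying the standard inner product $\langle\cdot,\cdot\rangle$. A vector valued switching function ($k$-switching function) for $\Sigma$ is a map $\zeta:V\to\Omega^k$ with $\langle\zeta(u),\zeta(v)\rangle\neq 0$ for every edge $uv\in E$; the switched signed graph $\Sigma^\zeta=(G,\sigma^\zeta)$ has $\sigma^\zeta(uv)=\sigma(uv)\operatorname{sgn}(\langle\zeta(u),\zeta(v)\rangle)$. The balancing dimension $\operatorname{bdim}(\Sigma)$ is the least integer $k\ge 1$ for which there is a $k$-switching function $\zeta:V\to\Omega^k$ such that $\Sigma^\zeta$ is all-positive (every edge has sign $+1$). The strong product $\Sigma_1\boxtimes\Sigma_2$ is the signed graph on the strong product $G_1\boxtimes G_2$ of the underlying graphs with signature $$\sigma((u_i,v_j)(u_k,v_l))=\begin{cases}\sigma_1(u_iu_k)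 & \text{if } u_i\sim u_k\text{ and } v_j=v_l,\\ \sigma_2(v_jv_l) & \text{if } u_i=u_k\text{ and } v_j\sim v_l,\\ \sigma_1(u_iu_k)\sigma_2(v_jv_l) & \text{if } u_i\sim u_k\text{ and } v_j\sim v_l.\end{cases}$$ -}

module Defs where

open import Data.Fin.Base as Fin using (Fin; zero; suc; combine; remQuot; finToFun; funToFin)
import Data.Fin.Properties as Fin
open import Data.Integer.Base as ℤ using (ℤ; 0ℤ; 1ℤ; -1ℤ)
import Data.Integer.Properties as ℤ
open import Data.List.Base using (List; []; _∷_; length)
open import Data.List.Relation.Unary.Unique.Propositional using (Unique)
open import Data.Nat.Base as ℕ using (ℕ; zero; suc; _≤_; z≤n; s≤s)
open import Data.Product.Base using (∃; _×_; _,_; proj₁; proj₂; uncurry)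
open import Data.Product.Function.NonDependent.Propositional using (_×-↔_)
open import Data.Sign.Base as Sign using (Sign)
import Data.Sign.Properties as Sign
open import Data.Sum.Base using (_⊎_; inj₁; inj₂)
open import Data.Vec.Functional using (Vector; removeAt)
open import Function.Base using (_∘_)
open import Function.Bundles using (_↔_; Inverse)
open import Function.Construct.Composition using (_↔-∘_)
open import Function.Construct.Symmetry using (↔-sym)
open import Level using (0ℓ)
open import Relation.Binary.Construct.Closure.ReflexiveTransitive using (Star; ε; _◅_)
open import Relation.Binary.Core using (Rel)
open import Relation.Binary.Definitions
  using (Decidable; DecidableEquality; Irreflexive; Symmetric; tri<; tri≈; tri>)
open import Relation.Binary.PropositionalEquality
open import Relation.Nullary
  using (Dec; yes; no; ¬_; ¬?; contradiction; map′; _×-dec_; _⊎-dec_)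
import Relation.Unary as U
open import Algebra.Properties.CommutativeMonoid.Sum ℤ.+-0-commutativeMonoid
  using (sum; sum-remove; sum-cong-≗; sum-replicate-zero)

------------------------------------------------------------------------
-- Finite simple graphs and signed graphs

record Graph : Set₁ where
  field
    V          : Set
    size       : ℕ
    enum       : V ↔ Fin size
    Adj        : Rel V 0ℓ
    adj?       : Decidable Adj
    Adj-sym    : Symmetric Adj
    Adj-irrefl : Irreflexive _≡_ Adj

  index : V → Fin size
  index = Inverse.to enum

  vertex : Fin size → V
  vertex = Inverse.from enum

  vertex-index : ∀ v → vertex (index v) ≡ v
  vertex-index = Inverse.strictlyInverseʳ enum

  index-vertex : ∀ i → index (vertex i) ≡ i
  index-vertex = Inverse.strictlyInverseˡ enum

  index-injective : ∀ {u v} → index u ≡ index v → u ≡ v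
  index-injective {u} {v} eq =
    trans (sym (vertex-index u)) (trans (cong vertex eq) (vertex-index v))

  _≟_ : DecidableEquality V
  u ≟ v = map′ index-injective (cong index) (index u Fin.≟ index v)

  Walk : Rel V 0ℓ
  Walk = Star Adj

  vertices : ∀ {u v} → Walk u v → List V
  vertices {u} ε       = u ∷ []
  vertices {u} (e ◅ w) = u ∷ vertices w

  -- A connected graph has at least one vertex.
  Connected : Set
  Connected = V × (∀ u v → Walk u v)

  -- The cycle is the closed walk  edge ◅ path.  Its vertices are those of
  -- path, which already include both ends of edge.
  record Cycle : Set where
    field
      {start next} : V
      edge         : Adj start next
      path         : Walk next start
      distinct     : Unique (vertices path)
      length≥3     : 3 ≤ length (vertices path)

record SignedGraph : Set₁ where
  field
    graph : Graph
  open Graph graph public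
  field
    σ     : ∀ {u v} → Adj u v → Sign
    -- The sign depends only on the unordered pair {u , v}; applied twice,
    -- this also makes it independent of the adjacency proof.
    σ-sym : ∀ {u v} (e : Adj u v) (e′ : Adj v u) → σ e ≡ σ e′

  σ-irrelevant : ∀ {u v} (e e′ : Adj u v) → σ e ≡ σ e′
  σ-irrelevant e e′ = trans (σ-sym e (Adj-sym e)) (σ-sym (Adj-sym e) e′)

  walkSign : ∀ {u v} → Walk u v → Sign
  walkSign ε       = Sign.+
  walkSign (e ◅ w) = σ e Sign.* walkSign w

  cycleSign : Cycle → Sign
  cycleSign c = walkSign (edge ◅ path)
    where open Cycle c

  Balanced : Set
  Balanced = ¬ (∃ λ c → cycleSign c ≡ Sign.-)

  AllPositive : Set
  AllPositive = ∀ {u v} (e : Adj u v) → σ e ≡ Sign.+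

------------------------------------------------------------------------
-- Strong products

module _ (G H : Graph) where
  private
    module G = Graph G
    module H = Graph H

  StrongAdj : Rel (G.V × H.V) 0ℓ
  StrongAdj (u , v) (u′ , v′) =
      (G.Adj u u′ × v ≡ v′)
    ⊎ (u ≡ u′ × H.Adj v v′)
    ⊎ (G.Adj u u′ × H.Adj v v′)

  private
    StrongAdj-sym : Symmetric StrongAdj
    StrongAdj-sym (inj₁ (e , refl))        = inj₁ (G.Adj-sym e , refl)
    StrongAdj-sym (inj₂ (inj₁ (refl , f))) = inj₂ (inj₁ (refl , H.Adj-sym f))
    StrongAdj-sym (inj₂ (inj₂ (e , f)))    = inj₂ (inj₂ (G.Adj-sym e , H.Adj-sym f))

    StrongAdj-irrefl : Irreflexive _≡_ StrongAdj
    StrongAdj-irrefl refl (inj₁ (e , _))        = G.Adj-irrefl refl e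
    StrongAdj-irrefl refl (inj₂ (inj₁ (_ , f))) = H.Adj-irrefl refl f
    StrongAdj-irrefl refl (inj₂ (inj₂ (e , _))) = G.Adj-irrefl refl e

  strongProduct : Graph
  strongProduct = record
    { V          = G.V × H.V
    ; size       = G.size ℕ.* H.size
    ; enum       = ↔-sym Fin.*↔× ↔-∘ (G.enum ×-↔ H.enum)
    ; Adj        = StrongAdj
    ; adj?       = λ (u , v) (u′ , v′) →
                     (G.adj? u u′ ×-dec (v H.≟ v′))
                     ⊎-dec ((u G.≟ u′) ×-dec H.adj? v v′)
                     ⊎-dec (G.adj? u u′ ×-dec H.adj? v v′)
    ; Adj-sym    = StrongAdj-sym
    ; Adj-irrefl = StrongAdj-irrefl
    }

module _ (Σ₁ Σ₂ : SignedGraph) where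
  private
    module Σ₁ = SignedGraph Σ₁
    module Σ₂ = SignedGraph Σ₂
    module P  = Graph (strongProduct Σ₁.graph Σ₂.graph)

  strongSign : ∀ {p q} → P.Adj p q → Sign
  strongSign (inj₁ (e , _))        = Σ₁.σ e
  strongSign (inj₂ (inj₁ (_ , f))) = Σ₂.σ f
  strongSign (inj₂ (inj₂ (e , f))) = Σ₁.σ e Sign.* Σ₂.σ f

  strongSign-sym : ∀ {p q} (e : P.Adj p q) (e′ : P.Adj q p) →
                   strongSign e ≡ strongSign e′
  strongSign-sym (inj₁ (e , _))        (inj₁ (e′ , _))          = Σ₁.σ-sym e e′
  strongSign-sym (inj₁ (e , _))        (inj₂ (inj₁ (eq , _)))   = contradiction e (Σ₁.Adj-irrefl (sym eq))
  strongSign-sym (inj₁ (_ , eq))       (inj₂ (inj₂ (_ , f′)))   = contradiction (Σ₂.Adj-sym f′) (Σ₂.Adj-irrefl eq)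
  strongSign-sym (inj₂ (inj₁ (eq , _))) (inj₁ (e′ , _))         = contradiction (Σ₁.Adj-sym e′) (Σ₁.Adj-irrefl eq)
  strongSign-sym (inj₂ (inj₁ (_ , f))) (inj₂ (inj₁ (_ , f′)))   = Σ₂.σ-sym f f′
  strongSign-sym (inj₂ (inj₁ (eq , _))) (inj₂ (inj₂ (e′ , _)))  = contradiction (Σ₁.Adj-sym e′) (Σ₁.Adj-irrefl eq)
  strongSign-sym (inj₂ (inj₂ (_ , f))) (inj₁ (_ , eq))          = contradiction (Σ₂.Adj-sym f) (Σ₂.Adj-irrefl eq)
  strongSign-sym (inj₂ (inj₂ (e , _))) (inj₂ (inj₁ (eq , _)))   = contradiction (Σ₁.Adj-sym e) (Σ₁.Adj-irrefl eq)
  strongSign-sym (inj₂ (inj₂ (e , f))) (inj₂ (inj₂ (e′ , f′)))  =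
    cong₂ Sign._*_ (Σ₁.σ-sym e e′) (Σ₂.σ-sym f f′)

infixr 7 _⊠_
_⊠_ : SignedGraph → SignedGraph → SignedGraph
Σ₁ ⊠ Σ₂ = record
  { graph = strongProduct (SignedGraph.graph Σ₁) (SignedGraph.graph Σ₂)
  ; σ     = strongSign Σ₁ Σ₂
  ; σ-sym = strongSign-sym Σ₁ Σ₂
  }

------------------------------------------------------------------------
-- Vector valued switching

data Ω : Set where
  -𝟏 𝟎 𝟏 : Ω

⟦_⟧ : Ω → ℤ
⟦ -𝟏 ⟧ = -1ℤ
⟦ 𝟎  ⟧ = 0ℤ
⟦ 𝟏  ⟧ = 1ℤ

-- The standard inner product of ℝᵏ takes integer values on Ωᵏ.
⟨_,_⟩ : ∀ {k} → Vector Ω k → Vector Ω k → ℤ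
⟨ x , y ⟩ = sum (λ i → ⟦ x i ⟧ ℤ.* ⟦ y i ⟧)

⟨,⟩-comm : ∀ {k} (x y : Vector Ω k) → ⟨ x , y ⟩ ≡ ⟨ y , x ⟩
⟨,⟩-comm x y = sum-cong-≗ (λ i → ℤ.*-comm ⟦ x i ⟧ ⟦ y i ⟧)

record SwitchingFunction (k : ℕ) (S : SignedGraph) : Set where
  open SignedGraph S
  field
    ζ       : V → Vector Ω k
    nonzero : ∀ {u v} → Adj u v → ⟨ ζ u , ζ v ⟩ ≢ 0ℤ

-- ℤ.sign sends 0 to +, but it is only applied to nonzero integers here.
switch : ∀ {k} (S : SignedGraph) → SwitchingFunction k S → SignedGraph
switch S sf = record
  { graph = graph
  ; σ     = λ {u} {v} e → σ e Sign.* ℤ.sign ⟨ ζ u , ζ v ⟩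
  ; σ-sym = λ {u} {v} e e′ →
      cong₂ Sign._*_ (σ-sym e e′) (cong ℤ.sign (⟨,⟩-comm (ζ u) (ζ v)))
  }
  where
  open SignedGraph S
  open SwitchingFunction sf

HasPositiveSwitching : SignedGraph → ℕ → Set
HasPositiveSwitching S k =
  ∃ λ (sf : SwitchingFunction k S) → SignedGraph.AllPositive (switch S sf)

IsBalancingDimension : SignedGraph → ℕ → Set
IsBalancingDimension S k =
    1 ≤ k
  × HasPositiveSwitching S k
  × (∀ j → 1 ≤ j → HasPositiveSwitching S j → k ≤ j)

------------------------------------------------------------------------
-- Every signed graph has a balancing dimension

-- One coordinate for each pair a < b of vertex indices, nonzero only at
-- the vertices a and b: it makes the inner product along each edge equal
-- to the sign of the edge.  A leading zero coordinate makes the dimension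
-- positive even when there are no vertices.
module _ (S : SignedGraph) where
  open SignedGraph S

  private
    fromSign : Sign → Ω
    fromSign Sign.+ = 𝟏
    fromSign Sign.- = -𝟏

    fromSign≢0 : ∀ s → ⟦ fromSign s ⟧ ≢ 0ℤ
    fromSign≢0 Sign.+ ()
    fromSign≢0 Sign.- ()

    sign-fromSign : ∀ s → s Sign.* ℤ.sign ⟦ fromSign s ⟧ ≡ Sign.+
    sign-fromSign Sign.+ = refl
    sign-fromSign Sign.- = refl

    adjSign : V → V → Ω
    adjSign x y with adj? x y
    ... | yes e = fromSign (σ e)
    ... | no  _ = 𝟎

    adjSign-edge : ∀ {x y} (e : Adj x y) → adjSign x y ≡ fromSign (σ e)
    adjSign-edge {x} {y} e with adj? x y
    ... | yes e′ = cong fromSign (σ-irrelevant e′ e)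
    ... | no ¬e  = contradiction e ¬e

    entry : Fin size → Fin size → V → Ω
    entry a b w with a Fin.<? b | index w Fin.≟ a | index w Fin.≟ b
    ... | no  _ | _     | _     = 𝟎
    ... | yes _ | yes _ | _     = 𝟏
    ... | yes _ | no  _ | yes _ = adjSign (vertex a) (vertex b)
    ... | yes _ | no  _ | no  _ = 𝟎

    pairVector : V → Vector Ω (suc (size ℕ.* size))
    pairVector w zero    = 𝟎
    pairVector w (suc i) = uncurry entry (remQuot {size} size i) w

    entry-lower : ∀ {u v} → index u Fin.< index v → entry (index u) (index v) u ≡ 𝟏
    entry-lower {u} {v} u<v
      with index u Fin.<? index v | index u Fin.≟ index u
    ... | no u≮v | _      = contradiction u<v u≮v
    ... | yes _  | no u≢u = contradiction refl u≢u
    ... | yes _  | yes _  = refl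

    entry-upper : ∀ {u v} (e : Adj u v) → index u Fin.< index v →
                  entry (index u) (index v) v ≡ fromSign (σ e)
    entry-upper {u} {v} e u<v
      with index u Fin.<? index v | index v Fin.≟ index u | index v Fin.≟ index v
    ... | no u≮v | _       | _      = contradiction u<v u≮v
    ... | yes _  | yes v≡u | _      = contradiction (sym v≡u) (Fin.<⇒≢ u<v)
    ... | yes _  | no  _   | no v≢v = contradiction refl v≢v
    ... | yes _  | no  _   | yes _  =
      trans (cong₂ adjSign (vertex-index u) (vertex-index v)) (adjSign-edge e)

    entry-other : ∀ {u v} → index u Fin.< index v → ∀ a b →
                  (a , b) ≢ (index u , index v) →
                  ⟦ entry a b u ⟧ ℤ.* ⟦ entry a b v ⟧ ≡ 0ℤ
    entry-other {u} {v} u<v a b ab≢uv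
      with a Fin.<? b | index u Fin.≟ a | index u Fin.≟ b | index v Fin.≟ a | index v Fin.≟ b
    ... | no  _   | _        | _        | _        | _        = refl
    ... | yes _   | no  _    | no  _    | _        | _        = refl
    ... | yes _   | yes refl | _        | yes v≡u  | _        = contradiction (sym v≡u) (Fin.<⇒≢ u<v)
    ... | yes _   | yes refl | _        | no  _    | yes refl = contradiction refl ab≢uv
    ... | yes _   | yes refl | _        | no  _    | no  _    = refl
    ... | yes v<u | no  _    | yes refl | yes refl | _        = contradiction v<u (Fin.<-asym u<v)
    ... | yes _   | no  _    | yes refl | no  _    | yes v≡u  = contradiction (sym v≡u) (Fin.<⇒≢ u<v)
    ... | yes _   | no  _    | yes refl | no  _    | no  _    = ℤ.*-zeroʳ ⟦ adjSign (vertex a) (vertex (index u)) ⟧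

    sum-single : ∀ {n} (t : Vector ℤ n) i → (∀ j → j ≢ i → t j ≡ 0ℤ) → sum t ≡ t i
    sum-single {suc n} t i t≡0 = begin
      sum t                        ≡⟨ sum-remove {i = i} t ⟩
      t i ℤ.+ sum (removeAt t i)   ≡⟨ cong (ℤ._+_ (t i)) (sum-cong-≗ λ j → t≡0 _ (Fin.punchInᵢ≢i i j)) ⟩
      t i ℤ.+ sum {n} (λ _ → 0ℤ)   ≡⟨ cong (ℤ._+_ (t i)) (sum-replicate-zero n) ⟩
      t i ℤ.+ 0ℤ                   ≡⟨ ℤ.+-identityʳ (t i) ⟩
      t i                          ∎
      where open ≡-Reasoning

    ⟨⟩-increasing : ∀ {u v} (e : Adj u v) → index u Fin.< index v →
                    ⟨ pairVector u , pairVector v ⟩ ≡ ⟦ fromSign (σ e) ⟧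
    ⟨⟩-increasing {u} {v} e u<v = begin
      ⟨ pairVector u , pairVector v ⟩       ≡⟨ ℤ.+-identityˡ _ ⟩
      sum t                                 ≡⟨ sum-single t uv off ⟩
      t uv                                  ≡⟨ cong f (Fin.remQuot-combine (index u) (index v)) ⟩
      f (index u , index v)                 ≡⟨ cong₂ (λ x y → ⟦ x ⟧ ℤ.* ⟦ y ⟧) (entry-lower u<v) (entry-upper e u<v) ⟩
      1ℤ ℤ.* ⟦ fromSign (σ e) ⟧             ≡⟨ ℤ.*-identityˡ _ ⟩
      ⟦ fromSign (σ e) ⟧                    ∎
      where
      open ≡-Reasoning
      f : Fin size × Fin size → ℤ
      f (a , b) = ⟦ entry a b u ⟧ ℤ.* ⟦ entry a b v ⟧
      t : Vector ℤ (size ℕ.* size)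
      t i = f (remQuot {size} size i)
      uv : Fin (size ℕ.* size)
      uv = combine (index u) (index v)
      off : ∀ j → j ≢ uv → t j ≡ 0ℤ
      off j j≢uv = entry-other u<v _ _ λ eq →
        j≢uv (trans (sym (Fin.combine-remQuot {size} size j)) (cong (uncurry combine) eq))

    ⟨⟩-edge : ∀ {u v} (e : Adj u v) →
              ⟨ pairVector u , pairVector v ⟩ ≡ ⟦ fromSign (σ e) ⟧
    ⟨⟩-edge {u} {v} e with Fin.<-cmp (index u) (index v)
    ... | tri< u<v _ _ = ⟨⟩-increasing e u<v
    ... | tri≈ _ u≡v _ = contradiction e (Adj-irrefl (index-injective u≡v))
    ... | tri> _ _ v<u = begin
      ⟨ pairVector u , pairVector v ⟩   ≡⟨ ⟨,⟩-comm (pairVector u) (pairVector v) ⟩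
      ⟨ pairVector v , pairVector u ⟩   ≡⟨ ⟨⟩-increasing (Adj-sym e) v<u ⟩
      ⟦ fromSign (σ (Adj-sym e)) ⟧      ≡⟨ cong (⟦_⟧ ∘ fromSign) (σ-sym (Adj-sym e) e) ⟩
      ⟦ fromSign (σ e) ⟧                ∎
      where open ≡-Reasoning

  hasPositiveSwitching : HasPositiveSwitching S (suc (size ℕ.* size))
  hasPositiveSwitching =
    record { ζ = pairVector ; nonzero = λ e eq → fromSign≢0 (σ e) (trans (sym (⟨⟩-edge e)) eq) } ,
    λ e → trans (cong (λ z → σ e Sign.* ℤ.sign z) (⟨⟩-edge e)) (sign-fromSign (σ e))

  private
    Good : ∀ {k} → (V → Vector Ω k) → Rel V 0ℓ
    Good ζ u v = (e : Adj u v) →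
      ⟨ ζ u , ζ v ⟩ ≢ 0ℤ × σ e Sign.* ℤ.sign ⟨ ζ u , ζ v ⟩ ≡ Sign.+

    good? : ∀ {k} (ζ : V → Vector Ω k) → Decidable (Good ζ)
    good? ζ u v with adj? u v
    ... | no ¬e = yes λ e → contradiction e ¬e
    ... | yes e = map′
      (λ (≢0 , pos) e′ → ≢0 , trans (cong (Sign._* _) (σ-irrelevant e′ e)) pos)
      (λ good → good e)
      (¬? (⟨ ζ u , ζ v ⟩ ℤ.≟ 0ℤ) ×-dec (σ e Sign.* ℤ.sign ⟨ ζ u , ζ v ⟩ Sign.≟ Sign.+))

    all-good? : ∀ {k} (ζ : V → Vector Ω k) → Dec (∀ u v → Good ζ u v)
    all-good? ζ = map′
      (λ good u v → subst₂ (Good ζ) (vertex-index u) (vertex-index v) (good (index u) (index v)))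
      (λ good i j → good (vertex i) (vertex j))
      (Fin.all? λ i → Fin.all? λ j → good? ζ (vertex i) (vertex j))

    toΩ : Fin 3 → Ω
    toΩ zero             = -𝟏
    toΩ (suc zero)       = 𝟎
    toΩ (suc (suc zero)) = 𝟏

    fromΩ : Ω → Fin 3
    fromΩ -𝟏 = zero
    fromΩ 𝟎  = suc zero
    fromΩ 𝟏  = suc (suc zero)

    toΩ-fromΩ : ∀ x → toΩ (fromΩ x) ≡ x
    toΩ-fromΩ -𝟏 = refl
    toΩ-fromΩ 𝟎  = refl
    toΩ-fromΩ 𝟏  = refl

    decode : ∀ {k} → Fin ((3 ℕ.^ k) ℕ.^ size) → V → Vector Ω k
    decode c v = toΩ ∘ finToFun (finToFun c (index v))

    encode : ∀ {k} → (V → Vector Ω k) → Fin ((3 ℕ.^ k) ℕ.^ size)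
    encode ζ = funToFin λ i → funToFin (fromΩ ∘ ζ (vertex i))

    decode-encode : ∀ {k} (ζ : V → Vector Ω k) v → decode (encode ζ) v ≗ ζ v
    decode-encode {k} ζ v i = begin
      toΩ (finToFun (finToFun (encode ζ) (index v)) i)
        ≡⟨ cong (λ c → toΩ (finToFun c i))
                (Fin.finToFun-funToFin (λ j → funToFin (fromΩ ∘ ζ (vertex j))) (index v)) ⟩
      toΩ (finToFun (funToFin (fromΩ ∘ ζ (vertex (index v)))) i)
        ≡⟨ cong toΩ (Fin.finToFun-funToFin (fromΩ ∘ ζ (vertex (index v))) i) ⟩
      toΩ (fromΩ (ζ (vertex (index v)) i))
        ≡⟨ toΩ-fromΩ _ ⟩
      ζ (vertex (index v)) i
        ≡⟨ cong (λ w → ζ w i) (vertex-index v) ⟩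
      ζ v i ∎
      where open ≡-Reasoning

    good-resp : ∀ {k} {ζ ζ′ : V → Vector Ω k} → (∀ v → ζ v ≗ ζ′ v) →
                ∀ {u v} → Good ζ u v → Good ζ′ u v
    good-resp {ζ = ζ} {ζ′} ζ≗ζ′ {u} {v} good e =
      subst (λ z → z ≢ 0ℤ × σ e Sign.* ℤ.sign z ≡ Sign.+) same (good e)
      where
      same : ⟨ ζ u , ζ v ⟩ ≡ ⟨ ζ′ u , ζ′ v ⟩
      same = sum-cong-≗ λ i → cong₂ (λ x y → ⟦ x ⟧ ℤ.* ⟦ y ⟧) (ζ≗ζ′ u i) (ζ≗ζ′ v i)

  hasPositiveSwitching? : U.Decidable (HasPositiveSwitching S)
  hasPositiveSwitching? k = map′
    (λ (c , good) →
      record { ζ = decode c ; nonzero = λ e → proj₁ (good _ _ e) } , λ e → proj₂ (good _ _ e))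
    (λ (sf , pos) → let open SwitchingFunction sf in
      encode ζ , λ u v → good-resp (λ w i → sym (decode-encode ζ w i)) λ e → nonzero e , pos e)
    (Fin.any? λ c → all-good? (decode {k} c))

private
  least : {P : U.Pred ℕ 0ℓ} → U.Decidable P → ∀ n → P n → ∃ λ k → P k × (∀ j → P j → k ≤ j)
  least P? n Pn with P? 0
  least P? n       Pn | yes P0 = 0 , P0 , λ _ _ → z≤n
  least P? zero    Pn | no ¬P0 = contradiction Pn ¬P0
  least {P} P? (suc n) Pn | no ¬P0 with least (P? ∘ suc) n Pn
  ... | k , Pk , k≤ = suc k , Pk , minimal
    where
    minimal : ∀ j → P j → suc k ≤ j
    minimal zero    P0 = contradiction P0 ¬P0
    minimal (suc j) Pj = s≤s (k≤ j Pj)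

balancingDimension : ∀ S → ∃ (IsBalancingDimension S)
balancingDimension S
  with least (hasPositiveSwitching? S ∘ suc) _ (hasPositiveSwitching S)
... | k , positive , k≤ =
  suc k , s≤s z≤n , positive , λ where (suc j) _ positive′ → s≤s (k≤ j positive′)

bdim : SignedGraph → ℕ
bdim S = proj₁ (balancingDimension S)

bdim-isBalancingDimension : ∀ S → IsBalancingDimension S (bdim S)
bdim-isBalancingDimension S = proj₂ (balancingDimension S)

{-# OPTIONS --safe #-}

-- A balanced connected signed graph has a potential s, that is, σ(vw) = s(v) s(w)
-- for every edge vw: deleting positive cycles turns every walk into a path of the
-- same sign, so closed walks are positive, and s(v) is the sign of any walk from a
-- base vertex to v.  If ζ positively switches Σ₁ and s is a potential of Σ₂, then
-- (u , v) ↦ s(v) ζ(u) positively switches Σ₁ ⊠ Σ₂, as soon as no ζ(u) vanishes;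
-- a vanishing ζ(u) can be replaced freely, since u is then isolated.  Conversely,
-- Σ₁ ⊠ Σ₂ contains copies of Σ₁, so a positive switching restricts.
module Submission where

open import Defs
open import Data.Fin.Base using (zero; suc)
open import Data.Integer.Base as ℤ using (ℤ; 0ℤ; 1ℤ; +[1+_]; -[1+_]; _◃_)
import Data.Integer.Properties as ℤ
open import Data.List.Base using (List; length)
open import Data.List.Membership.Propositional using (_∈_)
import Data.List.Membership.DecPropositional as DecMembership
open import Data.List.Relation.Binary.Sublist.Propositional using (_⊆_; []; _∷ʳ_; _∷_; ⊆-refl; minimum)
open import Data.List.Relation.Binary.Sublist.Propositional.Properties using (All-resp-⊆)
open import Data.List.Relation.Unary.All using ([])
open import Data.List.Relation.Unary.All.Properties using (¬Any⇒All¬; All¬⇒¬Any)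
open import Data.List.Relation.Unary.AllPairs using ([]; _∷_)
open import Data.List.Relation.Unary.Any using (here; there)
open import Data.List.Relation.Unary.Unique.Propositional using (Unique)
open import Data.Nat.Base using (ℕ; suc; _≤_; z≤n; s≤s)
import Data.Nat.Properties as ℕ
open import Data.Product.Base using (∃; _×_; _,_; proj₁; proj₂; swap)
open import Data.Sign.Base as Sign using (Sign)
import Data.Sign.Properties as Sign
open import Data.Sum.Base using (_⊎_; inj₁; inj₂)
open import Data.Vec.Functional using (Vector; replicate; tail)
open import Function.Base using (_∘_)
open import Relation.Binary.Construct.Closure.ReflexiveTransitive using (ε; _◅_; _◅◅_)
open import Relation.Binary.PropositionalEquality
open import Relation.Nullary using (yes; no; contradiction)
open import Algebra.Properties.Semiring.Sum ℤ.+-*-semiring using (sum-cong-≗; *-distribˡ-sum)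

Unique-resp-⊆ : ∀ {A : Set} {xs ys : List A} → xs ⊆ ys → Unique ys → Unique xs
Unique-resp-⊆ []             []           = []
Unique-resp-⊆ (_ ∷ʳ xs⊆ys)   (_ ∷ ys!)    = Unique-resp-⊆ xs⊆ys ys!
Unique-resp-⊆ (refl ∷ xs⊆ys) (y∉ys ∷ ys!) = All-resp-⊆ xs⊆ys y∉ys ∷ Unique-resp-⊆ xs⊆ys ys!

-- Balanced signed graphs

module _ (S : SignedGraph) where
  open SignedGraph S

  length-vertices>0 : ∀ {u v} (w : Walk u v) → 1 ≤ length (vertices w)
  length-vertices>0 ε       = s≤s z≤n
  length-vertices>0 (_ ◅ _) = s≤s z≤n

  target∈vertices : ∀ {u v} (w : Walk u v) → v ∈ vertices w
  target∈vertices ε       = here refl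
  target∈vertices (_ ◅ w) = there (target∈vertices w)

  walkSign-◅◅ : ∀ {u v w} (p : Walk u v) (q : Walk v w) →
                walkSign (p ◅◅ q) ≡ walkSign p Sign.* walkSign q
  walkSign-◅◅ ε       q = refl
  walkSign-◅◅ (e ◅ p) q =
    trans (cong (σ e Sign.*_) (walkSign-◅◅ p q)) (sym (Sign.*-assoc (σ e) _ _))

  -- Cutting at a visited vertex is what allows a closed part of a walk to be dropped. The sublist
  -- conditions ensure that both pieces of a path are paths again.
  splitWalk : ∀ {u v x} (w : Walk u v) → x ∈ vertices w →
              ∃ λ (p : Walk u x) → ∃ λ (q : Walk x v) →
                vertices p ⊆ vertices w × vertices q ⊆ vertices w ×
                walkSign w ≡ walkSign p Sign.* walkSign q
  splitWalk ε       (here refl) = ε , ε , ⊆-refl , ⊆-refl , refl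
  splitWalk (e ◅ w) (here refl) = ε , e ◅ w , refl ∷ minimum _ , ⊆-refl , refl
  splitWalk (e ◅ w) (there x∈w) with splitWalk w x∈w
  ... | p , q , p⊆w , q⊆w , eq =
    e ◅ p , q , refl ∷ p⊆w , _ ∷ʳ q⊆w ,
    trans (cong (σ e Sign.*_) eq) (sym (Sign.*-assoc (σ e) _ _))

  -- Only the empty walk qualifies: in any other closed walk the start recurs as the end.
  closedPath-positive : ∀ {u} (p : Walk u u) → Unique (vertices p) → walkSign p ≡ Sign.+
  closedPath-positive ε       _          = refl
  closedPath-positive (e ◅ p) (u∉p ∷ _) =
    contradiction (target∈vertices p) (All¬⇒¬Any u∉p)

  module _ (balanced : Balanced) where

    -- The number of edges of `p` decides: with none, `e` would be a loop; with one, the same edge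
    -- is traversed back and its sign squared; with two or more, the closed walk is a `Cycle`.
    edge◅path-positive : ∀ {u x} (e : Adj u x) (p : Walk x u) → Unique (vertices p) →
                         walkSign (e ◅ p) ≡ Sign.+
    edge◅path-positive e ε             _ = contradiction e (Adj-irrefl refl)
    edge◅path-positive e (e′ ◅ ε)      _ = begin
      σ e Sign.* (σ e′ Sign.* Sign.+)   ≡⟨ cong (σ e Sign.*_) (Sign.*-identityʳ (σ e′)) ⟩
      σ e Sign.* σ e′                   ≡⟨ cong (σ e Sign.*_) (σ-sym e′ e) ⟩
      σ e Sign.* σ e                    ≡⟨ Sign.s*s≡+ (σ e) ⟩
      Sign.+                            ∎
      where open ≡-Reasoning
    -- `Balanced` only refutes negative cycles, so positivity is obtained by splitting on the sign.
    edge◅path-positive e p@(_ ◅ _ ◅ q) unique with walkSign (e ◅ p) in eq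
    ... | Sign.+ = refl
    ... | Sign.- = contradiction (cycle , eq) balanced
      where
      cycle : Cycle
      cycle = record
        { edge = e ; path = p ; distinct = unique
        ; length≥3 = s≤s (s≤s (length-vertices>0 q)) }

    -- Loop erasure. If `u` already lies on the path `p` obtained from the rest, then `e` followed
    -- by `p` up to `u` is closed and positive, and the remainder of `p` has the right sign.
    walk⇒path : ∀ {u v} (w : Walk u v) →
                ∃ λ (p : Walk u v) → Unique (vertices p) × walkSign w ≡ walkSign p
    walk⇒path ε = ε , [] ∷ [] , refl
    walk⇒path {u} (e ◅ w) with walk⇒path w
    ... | p , unique , eq with DecMembership._∈?_ _≟_ u (vertices p)
    ...   | no u∉p  = e ◅ p , ¬Any⇒All¬ _ u∉p ∷ unique , cong (σ e Sign.*_) eq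
    ...   | yes u∈p with splitWalk p u∈p
    ...     | q , r , q⊆p , r⊆p , split = r , Unique-resp-⊆ r⊆p unique , (begin
      σ e Sign.* walkSign w                    ≡⟨ cong (σ e Sign.*_) (trans eq split) ⟩
      σ e Sign.* (walkSign q Sign.* walkSign r) ≡⟨ Sign.*-assoc (σ e) _ _ ⟨
      walkSign (e ◅ q) Sign.* walkSign r
        ≡⟨ cong (Sign._* walkSign r) (edge◅path-positive e q (Unique-resp-⊆ q⊆p unique)) ⟩
      walkSign r                               ∎)
      where open ≡-Reasoning

    closedWalk-positive : ∀ {u} (w : Walk u u) → walkSign w ≡ Sign.+
    closedWalk-positive w with walk⇒path w
    ... | p , unique , eq = trans eq (closedPath-positive p unique)

    -- Both walks are closed up by the same return walk, whose sign then cancels.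
    walkSign-unique : ∀ {u v} → Walk v u → (p q : Walk u v) → walkSign p ≡ walkSign q
    walkSign-unique r p q = Sign.*-cancelʳ-≡ (walkSign r) _ _
      (trans (closed p) (sym (closed q)))
      where
      closed : ∀ p → walkSign p Sign.* walkSign r ≡ Sign.+
      closed p = trans (sym (walkSign-◅◅ p r)) (closedWalk-positive (p ◅◅ r))

  IsPotential : (V → Sign) → Set
  IsPotential s = ∀ {u v} (e : Adj u v) → σ e ≡ s u Sign.* s v

  -- The chosen walk to `u` extended by `e` competes with the chosen walk to `v`. Their signs agree,
  -- which determines `σ e` because `s u` squares to `Sign.+`.
  balanced⇒potential : Connected → Balanced → ∃ IsPotential
  balanced⇒potential (o , walk) balanced = s , potential
    where
    s : V → Sign
    s v = walkSign (walk o v)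

    potential : IsPotential s
    potential {u} {v} e = begin
      σ e                             ≡⟨⟩
      Sign.+ Sign.* σ e               ≡⟨ cong (Sign._* σ e) (Sign.s*s≡+ (s u)) ⟨
      (s u Sign.* s u) Sign.* σ e     ≡⟨ Sign.*-assoc (s u) (s u) (σ e) ⟩
      s u Sign.* (s u Sign.* σ e)     ≡⟨ cong (λ t → s u Sign.* (s u Sign.* t)) (Sign.*-identityʳ (σ e)) ⟨
      s u Sign.* (s u Sign.* walkSign (e ◅ ε))
                                      ≡⟨ cong (s u Sign.*_) (walkSign-◅◅ (walk o u) (e ◅ ε)) ⟨
      s u Sign.* walkSign (walk o u ◅◅ e ◅ ε)
        ≡⟨ cong (s u Sign.*_) (walkSign-unique balanced (walk v o) (walk o u ◅◅ e ◅ ε) (walk o v)) ⟩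
      s u Sign.* s v                  ∎
      where open ≡-Reasoning

-- Inner products on Ωᵏ

infixr 8 _•_ _•ᵛ_

_•_ : Sign → Ω → Ω
Sign.+ • x  = x
Sign.- • -𝟏 = 𝟏
Sign.- • 𝟎  = 𝟎
Sign.- • 𝟏  = -𝟏

_•ᵛ_ : ∀ {k} → Sign → Vector Ω k → Vector Ω k
(s •ᵛ x) i = s • x i

-- The integer `s ◃ 1` is 1 or -1 according to `s`.
⟦•⟧ : ∀ s x → ⟦ s • x ⟧ ≡ (s ◃ 1) ℤ.* ⟦ x ⟧
⟦•⟧ Sign.+ x  = sym (ℤ.*-identityˡ ⟦ x ⟧)
⟦•⟧ Sign.- -𝟏 = refl
⟦•⟧ Sign.- 𝟎  = refl
⟦•⟧ Sign.- 𝟏  = refl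

⟨•,⟩ : ∀ {k} s (x y : Vector Ω k) → ⟨ s •ᵛ x , y ⟩ ≡ (s ◃ 1) ℤ.* ⟨ x , y ⟩
⟨•,⟩ s x y = begin
  ⟨ s •ᵛ x , y ⟩   ≡⟨ sum-cong-≗ (λ i → trans (cong (ℤ._* ⟦ y i ⟧) (⟦•⟧ s (x i)))
                                             (ℤ.*-assoc (s ◃ 1) ⟦ x i ⟧ ⟦ y i ⟧)) ⟩
  _                ≡⟨ *-distribˡ-sum (s ◃ 1) (λ i → ⟦ x i ⟧ ℤ.* ⟦ y i ⟧) ⟨
  (s ◃ 1) ℤ.* ⟨ x , y ⟩ ∎
  where open ≡-Reasoning

⟨•,•⟩ : ∀ {k} s t (x y : Vector Ω k) →
        ⟨ s •ᵛ x , t •ᵛ y ⟩ ≡ (s ◃ 1) ℤ.* ((t ◃ 1) ℤ.* ⟨ x , y ⟩)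
⟨•,•⟩ s t x y = begin
  ⟨ s •ᵛ x , t •ᵛ y ⟩                   ≡⟨ ⟨•,⟩ s x (t •ᵛ y) ⟩
  (s ◃ 1) ℤ.* ⟨ x , t •ᵛ y ⟩            ≡⟨ cong ((s ◃ 1) ℤ.*_) (⟨,⟩-comm x (t •ᵛ y)) ⟩
  (s ◃ 1) ℤ.* ⟨ t •ᵛ y , x ⟩            ≡⟨ cong ((s ◃ 1) ℤ.*_) (⟨•,⟩ t y x) ⟩
  (s ◃ 1) ℤ.* ((t ◃ 1) ℤ.* ⟨ y , x ⟩)   ≡⟨ cong (λ z → (s ◃ 1) ℤ.* ((t ◃ 1) ℤ.* z)) (⟨,⟩-comm y x) ⟩
  (s ◃ 1) ℤ.* ((t ◃ 1) ℤ.* ⟨ x , y ⟩)   ∎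
  where open ≡-Reasoning

-- These are the two demands of a positive switching on one edge, in the form in which `nonzero` and
-- `AllPositive` state them. Since signs square to `Sign.+`, the equation says that `s` is the sign
-- of `z`.
HasSign : Sign → ℤ → Set
HasSign s z = z ≢ 0ℤ × s Sign.* ℤ.sign z ≡ Sign.+

HasSign-* : ∀ t {s z} → HasSign s z → HasSign (t Sign.* s) ((t ◃ 1) ℤ.* z)
HasSign-* t      {s}      {ℤ.+ 0}    (z≢0 , _)  = contradiction refl z≢0
HasSign-* Sign.+ {s}      {+[1+ _ ]} (_   , eq) = (λ ()) , eq
HasSign-* Sign.+ {s}      { -[1+ _ ]} (_  , eq) = (λ ()) , eq
HasSign-* Sign.- {Sign.+} {+[1+ _ ]} _ = (λ ()) , refl
HasSign-* Sign.- {Sign.-} { -[1+ _ ]} _ = (λ ()) , refl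

⟨•,•⟩-HasSign : ∀ {k} s t {r} (x y : Vector Ω k) → HasSign r ⟨ x , y ⟩ →
                HasSign (s Sign.* (t Sign.* r)) ⟨ s •ᵛ x , t •ᵛ y ⟩
⟨•,•⟩-HasSign s t {r} x y h =
  subst (HasSign (s Sign.* (t Sign.* r))) (sym (⟨•,•⟩ s t x y))
    (HasSign-* s {t Sign.* r} (HasSign-* t {r} h))

⟨𝟎,⟩ : ∀ {k} {x : Vector Ω k} → (∀ i → x i ≡ 𝟎) → ∀ y → ⟨ x , y ⟩ ≡ 0ℤ
⟨𝟎,⟩ {ℕ.zero}  x≡𝟎 y = refl
⟨𝟎,⟩ {suc k}   x≡𝟎 y =
  cong₂ (λ a z → ⟦ a ⟧ ℤ.* ⟦ y zero ⟧ ℤ.+ z) (x≡𝟎 zero) (⟨𝟎,⟩ (x≡𝟎 ∘ suc) (tail y))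

1+0-positive : ∀ {z} → z ≡ 0ℤ → HasSign Sign.+ (1ℤ ℤ.+ z)
1+0-positive refl = (λ ()) , refl

square+positive : ∀ a {z} → HasSign Sign.+ z → HasSign Sign.+ (⟦ a ⟧ ℤ.* ⟦ a ⟧ ℤ.+ z)
square+positive _  {ℤ.+ 0}    (z≢0 , _) = contradiction refl z≢0
square+positive -𝟏 {+[1+ _ ]} _         = (λ ()) , refl
square+positive 𝟎  {+[1+ _ ]} _         = (λ ()) , refl
square+positive 𝟏  {+[1+ _ ]} _         = (λ ()) , refl

-- The inner product of `x` with itself is a sum of squares, positive as soon as one coordinate is
-- nonzero.
zero⊎positive : ∀ {k} (x : Vector Ω k) → (∀ i → x i ≡ 𝟎) ⊎ HasSign Sign.+ ⟨ x , x ⟩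
zero⊎positive {ℕ.zero} x = inj₁ λ ()
zero⊎positive {suc k}  x with x zero in eq | zero⊎positive (tail x)
... | 𝟎  | inj₁ x≡𝟎 = inj₁ λ where
  zero    → eq
  (suc i) → x≡𝟎 i
... | -𝟏 | inj₁ x≡𝟎 = inj₂ (1+0-positive (⟨𝟎,⟩ x≡𝟎 (tail x)))
... | 𝟏  | inj₁ x≡𝟎 = inj₂ (1+0-positive (⟨𝟎,⟩ x≡𝟎 (tail x)))
... | a  | inj₂ pos = inj₂ (square+positive a pos)

-- The all-ones vector is an arbitrary substitute for a zero vector.
nonvanishing : ∀ {k} → Vector Ω k → Vector Ω k
nonvanishing {k} x with zero⊎positive x
... | inj₁ _ = replicate k 𝟏
... | inj₂ _ = x

-- The dimension must be positive here: in dimension 0 the substitute vanishes too.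
nonvanishing-square : ∀ {k} (x : Vector Ω (suc k)) →
                      HasSign Sign.+ ⟨ nonvanishing x , nonvanishing x ⟩
nonvanishing-square {k} x with zero⊎positive x
... | inj₂ pos = pos
-- Applying the dichotomy again to the substitute avoids evaluating its square.
... | inj₁ _   with zero⊎positive (replicate (suc k) 𝟏)
...   | inj₁ 𝟏≡𝟎 = contradiction (𝟏≡𝟎 zero) λ ()
...   | inj₂ pos = pos

-- Hence the replacement leaves a switching function unchanged at the ends of every edge.
nonvanishing-id : ∀ {k} (x y : Vector Ω k) → ⟨ x , y ⟩ ≢ 0ℤ → nonvanishing x ≡ x
nonvanishing-id x y xy≢0 with zero⊎positive x
... | inj₁ x≡𝟎 = contradiction (⟨𝟎,⟩ x≡𝟎 y) xy≢0
... | inj₂ _   = refl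

-- Positive switchings

positiveSwitching : ∀ {k} (S : SignedGraph) → let open SignedGraph S in
  (ζ : V → Vector Ω k) → (∀ {u v} (e : Adj u v) → HasSign (σ e) ⟨ ζ u , ζ v ⟩) →
  HasPositiveSwitching S k
positiveSwitching S ζ h = record { ζ = ζ ; nonzero = proj₁ ∘ h } , proj₂ ∘ h

pullback : ∀ (S T : SignedGraph) {k} →
  let module S = SignedGraph S ; module T = SignedGraph T in
  (f : S.V → T.V) →
  (∀ {u v} (e : S.Adj u v) → ∃ λ (e′ : T.Adj (f u) (f v)) → T.σ e′ ≡ S.σ e) →
  HasPositiveSwitching T k → HasPositiveSwitching S k
pullback S T f f-edge (sf , positive) = positiveSwitching S (ζ ∘ f) λ e →
  let e′ , eq = f-edge e in
  nonzero e′ , subst (λ s → s Sign.* _ ≡ Sign.+) eq (positive e′)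
  where open SwitchingFunction sf

⊠-swap : ∀ Σ₁ Σ₂ {k} → HasPositiveSwitching (Σ₁ ⊠ Σ₂) k → HasPositiveSwitching (Σ₂ ⊠ Σ₁) k
⊠-swap Σ₁ Σ₂ = pullback (Σ₂ ⊠ Σ₁) (Σ₁ ⊠ Σ₂) swap λ where
  (inj₁ (e , eq))        → inj₂ (inj₁ (eq , e)) , refl
  (inj₂ (inj₁ (eq , f))) → inj₁ (f , eq) , refl
  (inj₂ (inj₂ (e , f)))  → inj₂ (inj₂ (f , e)) , Sign.*-comm (SignedGraph.σ Σ₁ f) _

⊠-restrict : ∀ Σ₁ Σ₂ {k} → SignedGraph.V Σ₂ →
             HasPositiveSwitching (Σ₁ ⊠ Σ₂) k → HasPositiveSwitching Σ₁ k
⊠-restrict Σ₁ Σ₂ v = pullback Σ₁ (Σ₁ ⊠ Σ₂) (_, v) λ e → inj₁ (e , refl) , refl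

⊠-extend : ∀ Σ₁ Σ₂ {k} → 1 ≤ k → ∃ (IsPotential Σ₂) →
           HasPositiveSwitching Σ₁ k → HasPositiveSwitching (Σ₁ ⊠ Σ₂) k
⊠-extend Σ₁ Σ₂ {suc k} _ (s , potential) (sf , positive) =
  positiveSwitching (Σ₁ ⊠ Σ₂) θ hasSign
  where
  module Σ₁ = SignedGraph Σ₁
  module Σ₂ = SignedGraph Σ₂
  open SwitchingFunction sf

  η : Σ₁.V → Vector Ω (suc k)
  η u = nonvanishing (ζ u)

  η≡ζ : ∀ {u u′} → Σ₁.Adj u u′ → η u ≡ ζ u
  η≡ζ {u} {u′} e = nonvanishing-id (ζ u) (ζ u′) (nonzero e)

  η-edge : ∀ {u u′} (e : Σ₁.Adj u u′) → HasSign (Σ₁.σ e) ⟨ η u , η u′ ⟩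
  η-edge e = subst₂ (λ x y → HasSign (Σ₁.σ e) ⟨ x , y ⟩) (sym (η≡ζ e)) (sym (η≡ζ (Σ₁.Adj-sym e)))
    (nonzero e , positive e)

  θ : Σ₁.V × Σ₂.V → Vector Ω (suc k)
  θ (u , v) = s v •ᵛ η u

  -- Reduces each of the three kinds of product edges to an identity between signs.
  scale : ∀ {u u′ v v′ r r′} → s v Sign.* (s v′ Sign.* r) ≡ r′ →
          HasSign r ⟨ η u , η u′ ⟩ → HasSign r′ ⟨ θ (u , v) , θ (u′ , v′) ⟩
  scale {u} {u′} {v} {v′} eq h =
    subst (λ r → HasSign r ⟨ θ (u , v) , θ (u′ , v′) ⟩) eq
      (⟨•,•⟩-HasSign (s v) (s v′) (η u) (η u′) h)

  hasSign : ∀ {p q} (e : SignedGraph.Adj (Σ₁ ⊠ Σ₂) p q) →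
            HasSign (SignedGraph.σ (Σ₁ ⊠ Σ₂) e) ⟨ θ p , θ q ⟩
  hasSign {_ , v} (inj₁ (e , refl)) = scale (begin
    s v Sign.* (s v Sign.* Σ₁.σ e)   ≡⟨ Sign.*-assoc (s v) (s v) (Σ₁.σ e) ⟨
    (s v Sign.* s v) Sign.* Σ₁.σ e   ≡⟨ cong (Sign._* Σ₁.σ e) (Sign.s*s≡+ (s v)) ⟩
    Σ₁.σ e                           ∎) (η-edge e)
    where open ≡-Reasoning
  -- Inside a copy of `Σ₂` both ends carry plus or minus the same vector `η u`, whose square has to
  -- be positive; this is why `η` replaces `ζ`.
  hasSign {u , v} {_ , v′} (inj₂ (inj₁ (refl , f))) = scale (begin
    s v Sign.* (s v′ Sign.* Sign.+)   ≡⟨ cong (s v Sign.*_) (Sign.*-identityʳ (s v′)) ⟩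
    s v Sign.* s v′                   ≡⟨ potential f ⟨
    Σ₂.σ f                            ∎) (nonvanishing-square (ζ u))
    where open ≡-Reasoning
  hasSign {_ , v} {_ , v′} (inj₂ (inj₂ (e , f))) = scale (begin
    s v Sign.* (s v′ Sign.* Σ₁.σ e)   ≡⟨ Sign.*-assoc (s v) (s v′) (Σ₁.σ e) ⟨
    (s v Sign.* s v′) Sign.* Σ₁.σ e   ≡⟨ cong (Sign._* Σ₁.σ e) (potential f) ⟨
    Σ₂.σ f Sign.* Σ₁.σ e              ≡⟨ Sign.*-comm (Σ₂.σ f) (Σ₁.σ e) ⟩
    Σ₁.σ e Sign.* Σ₂.σ f              ∎) (η-edge e)
    where open ≡-Reasoning

-- Comparison of balancing dimensions

balancingDimension-mono : ∀ S T {j k} →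
  (∀ {k} → 1 ≤ k → HasPositiveSwitching T k → HasPositiveSwitching S k) →
  IsBalancingDimension S j → IsBalancingDimension T k → j ≤ k
balancingDimension-mono S T T⇒S (_ , _ , minimal) (1≤k , positive , _) =
  minimal _ 1≤k (T⇒S 1≤k positive)

bdim-mono : ∀ S T → (∀ {k} → 1 ≤ k → HasPositiveSwitching T k → HasPositiveSwitching S k) →
            bdim S ≤ bdim T
bdim-mono S T T⇒S = balancingDimension-mono S T T⇒S
  (bdim-isBalancingDimension S) (bdim-isBalancingDimension T)

bdim-⊠-balancedʳ : ∀ Σ₁ Σ₂ → SignedGraph.Connected Σ₂ → SignedGraph.Balanced Σ₂ →
                   bdim (Σ₁ ⊠ Σ₂) ≡ bdim Σ₁
bdim-⊠-balancedʳ Σ₁ Σ₂ connected balanced = ℕ.≤-antisym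
  (bdim-mono (Σ₁ ⊠ Σ₂) Σ₁ λ 1≤k → ⊠-extend Σ₁ Σ₂ 1≤k (balanced⇒potential Σ₂ connected balanced))
  -- Connectedness includes a vertex of `Σ₂`, which selects the copy of `Σ₁` to restrict to.
  (bdim-mono Σ₁ (Σ₁ ⊠ Σ₂) λ _ → ⊠-restrict Σ₁ Σ₂ (proj₁ connected))

-- Exchanging coordinates preserves edges and signs; this carries the case of balanced `Σ₂` over to
-- balanced `Σ₁`.
bdim-⊠-comm : ∀ Σ₁ Σ₂ → bdim (Σ₁ ⊠ Σ₂) ≡ bdim (Σ₂ ⊠ Σ₁)
bdim-⊠-comm Σ₁ Σ₂ = ℕ.≤-antisym
  (bdim-mono (Σ₁ ⊠ Σ₂) (Σ₂ ⊠ Σ₁) λ _ → ⊠-swap Σ₂ Σ₁)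
  (bdim-mono (Σ₂ ⊠ Σ₁) (Σ₁ ⊠ Σ₂) λ _ → ⊠-swap Σ₁ Σ₂)

theorem2p35 : (Σ₁ Σ₂ : SignedGraph) →
    SignedGraph.Connected Σ₁ → SignedGraph.Connected Σ₂ →
    (SignedGraph.Balanced Σ₂ → bdim (Σ₁ ⊠ Σ₂) ≡ bdim Σ₁)
    × (SignedGraph.Balanced Σ₁ → bdim (Σ₁ ⊠ Σ₂) ≡ bdim Σ₂)
theorem2p35 Σ₁ Σ₂ connected₁ connected₂ =
  bdim-⊠-balancedʳ Σ₁ Σ₂ connected₂ ,
  trans (bdim-⊠-comm Σ₁ Σ₂) ∘ bdim-⊠-balancedʳ Σ₂ Σ₁ connected₁
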